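{- $\rhd_{R_{\diamond}}\,=\,\rhd_{\diamond}$ with $R_{\diamond}\,=\,\Bigl\{ \frac{p\, , \, q}{p\diamond q}\,,\, \frac{p\diamond q}{p\, , \, q}\Bigr\}$.
   Context: $\rhd_\diamond$ is the multiple-conclusion (Scottian) logic of the two-valued Nmatrix $\langle\{0,1\},\cdot,\{1\}\rangle$ with one binary connective $\diamond$ (platypus) interpreted by $\diamond(0,0)=\{0\}$, $\diamond(1,1)=\{1\}$, $\diamond(0,1)=\diamond(1,0)=\{0,1\}$: $\Gamma\rhd_\diamond\Delta$ iff every valuation making all of $\Gamma$ equal to $1$ makes some member of $\Delta$ equal to $1$. For a set $R$ of multiple-conclusion rules $\frac{\Gamma}{\Delta}$ (premises read conjunctively, conclusions disjunctively), $\rhd_R$ is the closure of $R$ under overlap, dilution, cut and substitution invariance. -}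

module Defs where

open import Data.Bool.Base using (Bool; true; false)
open import Data.Nat.Base using (ℕ)
open import Data.Product.Base using (_×_; _,_; ∃-syntax)
open import Level using (0ℓ; suc; _⊔_)
open import Relation.Binary.Core using (Rel)
open import Relation.Binary.PropositionalEquality.Core using (_≡_; refl)
open import Relation.Unary
  using (Pred; _∈_; _⊆_; _≐_; _∪_; _≬_; _⊥_; _⊢_; ｛_｝; U; Satisfiable)

infixr 7 _⋄_

data Formula : Set where
  var : ℕ → Formula
  _⋄_ : Formula → Formula → Formula

-- Arbitrary, possibly infinite, sets of formulas.
FormulaSet : Set₁
FormulaSet = Pred Formula 0ℓ

Substitution : Set
Substitution = ℕ → Formula

_[_] : Formula → Substitution → Formula
var n   [ σ ] = σ n
(φ ⋄ ψ) [ σ ] = (φ [ σ ]) ⋄ (ψ [ σ ])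

_⟦_⟧ : FormulaSet → Substitution → FormulaSet
(Γ ⟦ σ ⟧) φ = ∃[ γ ] (γ ∈ Γ × φ ≡ γ [ σ ])

record Nmatrix : Set₁ where
  field
    Value      : Set
    op         : Value → Value → Pred Value 0ℓ
    nonempty   : ∀ x y → Satisfiable (op x y)
    Designated : Pred Value 0ℓ

module _ (M : Nmatrix) where
  open Nmatrix M

  -- The value of a compound formula is chosen per formula, so a valuation is
  -- not determined by its values on variables.
  IsValuation : (Formula → Value) → Set
  IsValuation v = ∀ φ ψ → v (φ ⋄ ψ) ∈ op (v φ) (v ψ)

  -- v ⊢ Designated is the preimage of Designated under v.
  Entails : Rel FormulaSet 0ℓ
  Entails Γ Δ =
    ∀ v → IsValuation v → Γ ⊆ (v ⊢ Designated) → Δ ≬ (v ⊢ Designated)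

platypus : Nmatrix
platypus = record
  { Value      = Bool
  ; op         = table
  ; nonempty   = table-nonempty
  ; Designated = ｛ true ｝
  }
  where
  table : Bool → Bool → Pred Bool 0ℓ
  table false false = ｛ false ｝
  table false true  = U
  table true  false = U
  table true  true  = ｛ true ｝

  table-nonempty : ∀ x y → Satisfiable (table x y)
  table-nonempty false false = false , refl
  table-nonempty false true  = false , _
  table-nonempty true  false = false , _
  table-nonempty true  true  = true  , refl

-- Either part may be empty.
IsPartition : FormulaSet → FormulaSet → FormulaSet → Set
IsPartition Ω Ω̄ Ξ = Ω ∪ Ω̄ ≐ Ξ × Ω ⊥ Ω̄

-- The least Scottian consequence relation containing R. Dilution is stated
-- with inclusions instead of unions, which also makes the relation invariant
-- under extensional equality of sets. Cut is cut for sets (Shoesmith and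
-- Smiley), the form appropriate to infinite sets of premises and conclusions.
data Closure {ℓ} (R : Rel FormulaSet ℓ) : Rel FormulaSet (suc 0ℓ ⊔ ℓ) where
  rule     : ∀ {Γ Δ} → R Γ Δ → Closure R Γ Δ
  overlaps : ∀ {Γ Δ} → Γ ≬ Δ → Closure R Γ Δ
  dilution : ∀ {Γ Γ′ Δ Δ′} → Γ ⊆ Γ′ → Δ ⊆ Δ′ → Closure R Γ Δ → Closure R Γ′ Δ′
  cut      : ∀ {Γ Δ} Ξ →
             (∀ Ω Ω̄ → IsPartition Ω Ω̄ Ξ → Closure R (Γ ∪ Ω) (Ω̄ ∪ Δ)) →
             Closure R Γ Δ
  subst    : ∀ {Γ Δ} σ → Closure R Γ Δ → Closure R (Γ ⟦ σ ⟧) (Δ ⟦ σ ⟧)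

private
  p q : Formula
  p = var 0
  q = var 1

data R⋄ : Rel FormulaSet 0ℓ where
  ⋄-intro : R⋄ (｛ p ｝ ∪ ｛ q ｝) ｛ p ⋄ q ｝
  ⋄-elim  : R⋄ ｛ p ⋄ q ｝ (｛ p ｝ ∪ ｛ q ｝)

{-# OPTIONS --safe #-}

-- Soundness: a valuation v splits any cut set Ξ into its true and its false
-- part, and for this partition the cut premise is already true at v.
-- Completeness: cut on the set of all formulas. A partition of all formulas
-- into Ω and Ω̄ either violates an instance of one of the two rules, or has Ω
-- as the set of formulas true at some valuation.

module Submission where

open import Defs
open import Axiom.ExcludedMiddle using (ExcludedMiddle)
open import Level using (0ℓ)
open import Data.Bool.Base using (Bool; true; false)
open import Data.Nat.Base using (zero; suc)
open import Data.Product.Base using (_×_; _,_; ∃-syntax)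
open import Data.Sum.Base using (_⊎_; inj₁; inj₂)
open import Data.Unit.Base using (tt)
open import Relation.Binary.Core using (Rel; _⇒_; _⇔_)
open import Relation.Binary.PropositionalEquality using (_≡_; refl; sym; trans)
open import Relation.Nullary using (¬_; yes; no; contradiction)
open import Relation.Unary using (_∈_; _⊆_; _∪_; _∩_; _≬_; _⊢_; ｛_｝; U)

true-part : (Formula → Bool) → FormulaSet
true-part v = v ⊢ ｛ true ｝

false-part : (Formula → Bool) → FormulaSet
false-part v = v ⊢ ｛ false ｝

true-false-disjoint : ∀ v {φ} → φ ∈ true-part v → ¬ φ ∈ false-part v
true-false-disjoint v t f with () ← trans t (sym f)

true-false-partition : ∀ v Ξ → IsPartition (Ξ ∩ true-part v) (Ξ ∩ false-part v) Ξ
true-false-partition v Ξ =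
  ( (λ { (inj₁ (φ∈Ξ , _)) → φ∈Ξ ; (inj₂ (φ∈Ξ , _)) → φ∈Ξ })
  , λ {φ} φ∈Ξ → split φ φ∈Ξ )
  , λ { ((_ , t) , (_ , f)) → true-false-disjoint v t f }
  where
  split : ∀ φ → φ ∈ Ξ → φ ∈ ((Ξ ∩ true-part v) ∪ (Ξ ∩ false-part v))
  split φ φ∈Ξ with v φ
  ... | true  = inj₁ (φ∈Ξ , refl)
  ... | false = inj₂ (φ∈Ξ , refl)

-- Each rule rests on one deterministic table entry: introduction on `table true true`, elimination
-- on `table false false`, which would falsify the premise.
R⋄-sound : R⋄ ⇒ Entails platypus
R⋄-sound ⋄-intro v val Γ-true
  with v (var 0) | v (var 1) | Γ-true (inj₁ refl) | Γ-true (inj₂ refl)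
     | val (var 0) (var 1)
... | true | true | refl | refl | t = _ , refl , t
R⋄-sound ⋄-elim v val Γ-true
  with v (var 0) in eq₀ | v (var 1) in eq₁ | val (var 0) (var 1)
... | true  | _     | _ = _ , inj₁ refl , sym eq₀
... | false | true  | _ = _ , inj₂ refl , sym eq₁
... | false | false | f = contradiction f (true-false-disjoint v (Γ-true refl))

Closure-sound : ∀ {ℓ} {R : Rel FormulaSet ℓ} →
                R ⇒ Entails platypus → Closure R ⇒ Entails platypus
Closure-sound R-sound (rule r) = R-sound r
Closure-sound R-sound (overlaps (φ , φ∈Γ , φ∈Δ)) v val Γ-true =
  φ , φ∈Δ , Γ-true φ∈Γ
Closure-sound R-sound (dilution Γ⊆Γ′ Δ⊆Δ′ d) v val Γ′-true
  with φ , φ∈Δ , t ← Closure-sound R-sound d v val (λ φ∈Γ → Γ′-true (Γ⊆Γ′ φ∈Γ))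
  = φ , Δ⊆Δ′ φ∈Δ , t
Closure-sound R-sound (cut {Γ} Ξ d) v val Γ-true
  with Closure-sound R-sound (d _ _ (true-false-partition v Ξ)) v val premises-true
  where
  premises-true : Γ ∪ (Ξ ∩ true-part v) ⊆ true-part v
  premises-true (inj₁ φ∈Γ)     = Γ-true φ∈Γ
  premises-true (inj₂ (_ , t)) = t
-- The true conclusion cannot come from the false part of `Ξ`, so it lies in `Δ`.
... | φ , inj₁ (_ , f) , t = contradiction f (true-false-disjoint v t)
... | φ , inj₂ φ∈Δ     , t = φ , φ∈Δ , t
-- Substitution commutes with `⋄` by computation, so `v` after `σ` is again a valuation, and the
-- induction hypothesis applies to it.
Closure-sound R-sound (subst σ d) v val Γσ-true
  with φ , φ∈Δ , t ← Closure-sound R-sound d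
                       (λ φ → v (φ [ σ ]))
                       (λ φ ψ → val (φ [ σ ]) (ψ [ σ ]))
                       (λ γ∈Γ → Γσ-true (_ , γ∈Γ , refl))
  = _ , (φ , φ∈Δ , refl) , t

Violates : FormulaSet → FormulaSet → Formula → Formula → Set
Violates Γ Δ φ ψ = (φ ∈ Γ × ψ ∈ Γ × φ ⋄ ψ ∈ Δ)
                 ⊎ (φ ⋄ ψ ∈ Γ × φ ∈ Δ × ψ ∈ Δ)

violation⇒derivable : ∀ {Γ Δ φ ψ} → Violates Γ Δ φ ψ → Closure R⋄ Γ Δ
violation⇒derivable {φ = φ} {ψ} = derive
  where
  σ : Substitution
  σ zero    = φ
  -- Only `var 1` matters here: the rules mention no later variable.
  σ (suc _) = ψ

  derive : ∀ {Γ Δ} → Violates Γ Δ φ ψ → Closure R⋄ Γ Δ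
  derive (inj₁ (φ∈Γ , ψ∈Γ , φ⋄ψ∈Δ)) =
    dilution
      (λ { (_ , inj₁ refl , refl) → φ∈Γ ; (_ , inj₂ refl , refl) → ψ∈Γ })
      (λ { (_ , refl , refl) → φ⋄ψ∈Δ })
      (subst σ (rule ⋄-intro))
  derive (inj₂ (φ⋄ψ∈Γ , φ∈Δ , ψ∈Δ)) =
    dilution
      (λ { (_ , refl , refl) → φ⋄ψ∈Γ })
      (λ { (_ , inj₁ refl , refl) → φ∈Δ ; (_ , inj₂ refl , refl) → ψ∈Δ })
      (subst σ (rule ⋄-elim))

module _ {Ω Ω̄ : FormulaSet} (side : ∀ φ → φ ∈ (Ω ∪ Ω̄)) where

  characteristic : Formula → Bool
  characteristic φ with side φ
  ... | inj₁ _ = true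
  ... | inj₂ _ = false

  characteristic-true⇒∈Ω : ∀ {φ} → φ ∈ true-part characteristic → φ ∈ Ω
  characteristic-true⇒∈Ω {φ} t with side φ
  ... | inj₁ φ∈Ω = φ∈Ω

  -- A formula in both sets takes the value of the side that `side` picks, so the hypothesis is
  -- absence from `Ω̄` rather than membership in `Ω`.
  ∉Ω̄⇒characteristic-true : ∀ {φ} → ¬ φ ∈ Ω̄ → φ ∈ true-part characteristic
  ∉Ω̄⇒characteristic-true {φ} φ∉Ω̄ with side φ
  ... | inj₁ _   = refl
  ... | inj₂ φ∈Ω̄ = contradiction φ∈Ω̄ φ∉Ω̄

  -- The table constrains a compound only when its arguments agree, and the two ways to break that
  -- constraint are the two kinds of violation. When they differ, any value is allowed.
  characteristic-valuation : (∀ {φ ψ} → ¬ Violates Ω Ω̄ φ ψ) →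
                             IsValuation platypus characteristic
  characteristic-valuation ok φ ψ with side φ | side ψ | side (φ ⋄ ψ)
  ... | inj₁ _   | inj₁ _   | inj₁ _ = refl
  ... | inj₁ φ∈Ω | inj₁ ψ∈Ω | inj₂ c = contradiction (inj₁ (φ∈Ω , ψ∈Ω , c)) ok
  ... | inj₁ _   | inj₂ _   | _      = tt
  ... | inj₂ _   | inj₁ _   | _      = tt
  ... | inj₂ φ∈Ω̄ | inj₂ ψ∈Ω̄ | inj₁ c = contradiction (inj₂ (c , φ∈Ω̄ , ψ∈Ω̄)) ok
  ... | inj₂ _   | inj₂ _   | inj₂ _ = refl

complete : ExcludedMiddle 0ℓ → Entails platypus ⇒ Closure R⋄
complete em {Γ} {Δ} Γ⊨Δ = cut U λ Ω Ω̄ ((_ , cover) , _) →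
  derive Ω Ω̄ (λ φ → cover {φ} tt)
  where
  derive : ∀ Ω Ω̄ → (∀ φ → φ ∈ (Ω ∪ Ω̄)) → Closure R⋄ (Γ ∪ Ω) (Ω̄ ∪ Δ)
  derive Ω Ω̄ side
    with em {Γ ≬ Ω̄} | em {∃[ φ ] ∃[ ψ ] Violates Ω Ω̄ φ ψ}
  ... | yes (φ , φ∈Γ , φ∈Ω̄) | _ = overlaps (φ , inj₁ φ∈Γ , inj₁ φ∈Ω̄)
  ... | no _ | yes (_ , _ , viol) =
    dilution inj₂ inj₁ (violation⇒derivable viol)
  ... | no Γ∩Ω̄=∅ | no ok
    -- Since `Γ` misses `Ω̄`, all of `Γ` is true at the characteristic valuation. The entailment
    -- then yields a true member of `Δ`, which lies in `Ω` and gives an overlap.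
    with φ , φ∈Δ , t ← Γ⊨Δ (characteristic side)
                           (characteristic-valuation side λ viol → ok (_ , _ , viol))
                           (λ φ∈Γ → ∉Ω̄⇒characteristic-true side λ φ∈Ω̄ → Γ∩Ω̄=∅ (_ , φ∈Γ , φ∈Ω̄))
    = overlaps (φ , inj₂ (characteristic-true⇒∈Ω side t) , inj₂ φ∈Δ)

theorem3 : ExcludedMiddle 0ℓ → Closure R⋄ ⇔ Entails platypus
theorem3 em = Closure-sound R⋄-sound , complete em
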